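{- Let $\Sigma$ be a signature and let $\mathcal{I},\mathcal{I}'$ be $\Sigma$-models. If there exists a morphism $\mu:\Delta^{\mathcal{I}}\to\Delta^{\mathcal{I}'}$, then for all concept descriptions $C,D\in\mathcal{EC}(\Sigma)$: $$\mathcal{I}'\models C\sqsubseteq D\implies\mathcal{I}\models C\sqsubseteq D.$$
   Context: A signature $\Sigma=(N_C,N_R)$ consists of a set $N_C$ of concept names and a set $N_R$ of role names. The set $\mathcal{EC}(\Sigma)$ of concept descriptions (description logic $\mathcal{ALC}$) is inductively generated by: $\bot,\top$; every $c\in N_C$; $C\sqcup D$, $C\sqcap D$, $C^c$ for $C,D\in\mathcal{EC}(\Sigma)$; $\forall r.C$, $\exists r.C$ for $C\in\mathcal{EC}(\Sigma)$, $r\in N_R$. A $\Sigma$-model $\mathcal{I}$ consists of a non-empty set $\Delta^{\mathcal{I}}$ (the carrier), a subset $c^{\mathcal{I}}\subseteq\Delta^{\mathcal{I}}$ for each $c\in N_C$ and a binary relation $r^{\mathcal{I}}\subseteq\Delta^{\mathcal{I}}\times\Delta^{\mathcal{I}}$ for each $r\in N_R$. The evaluation $C^{\mathcal{I}}\subseteq\Delta^{\mathcal{I}}$ of a concept description is defined by: $\top^{\mathcal{I}}=\Delta^{\mathcal{I}}$, $\bot^{\mathcal{I}}=\emptyset$, concept names are evaluated as given, $\sqcup,\sqcap$ are union and intersection, $(C^c)^{\mathcal{I}}=\Delta^{\mathcal{I}}\setminus C^{\mathcal{I}}$, $(\forall r.C)^{\mathcal{I}}=\{x\mid \forall y,\ (x,y)\in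 r^{\mathcal{I}}\Rightarrow y\in C^{\mathcal{I}}\}$, $(\exists r.C)^{\mathcal{I}}=\{x\mid \exists y,\ (x,y)\in r^{\mathcal{I}}\text{ and } y\in C^{\mathcal{I}}\}$. $\mathcal{I}\models C\sqsubseteq D$ means $C^{\mathcal{I}}\subseteq D^{\mathcal{I}}$. A morphism from $\mathcal{I}$ to $\mathcal{I}'$ is a map $\mu:\Delta^{\mathcal{I}}\to\Delta^{\mathcal{I}'}$ such that (1) for all $c\in N_C$, $a\in\Delta^{\mathcal{I}}$: $a\in c^{\mathcal{I}}\Leftrightarrow\mu(a)\in c^{\mathcal{I}'}$; (2) for all $r\in N_R$: (a) $(a,b)\in r^{\mathcal{I}}$ implies $(\mu(a),\mu(b))\in r^{\mathcal{I}'}$; (b) for all $a\in\Delta^{\mathcal{I}}$, $a'\in\Delta^{\mathcal{I}'}$ with $(\mu(a),a')\in r^{\mathcal{I}'}$ there is $b\in\Delta^{\mathcal{I}}$ with $(a,b)\in r^{\mathcal{I}}$ and $\mu(b)=a'$. -}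

module Defs where

open import Data.Product using (∃-syntax; _×_)
open import Function using (_⇔_)
open import Level using (Level; suc; _⊔_)
open import Relation.Binary.Core using (Rel)
open import Relation.Binary.PropositionalEquality using (_≡_)
open import Relation.Unary using (Pred; _∈_; _⊆_; _∪_; _∩_; ∁)
open import Relation.Unary.Polymorphic using (∅; U)

record Signature (c r : Level) : Set (suc (c ⊔ r)) where
  field
    ConceptName : Set c
    RoleName    : Set r

open Signature public

infix  9 _ᶜ
infixr 8 ∀[_]∙_ ∃[_]∙_
infixr 7 _⊓_
infixr 6 _⊔ᶜ_

data Concept {c r : Level} (S : Signature c r) : Set (c ⊔ r) where
  ⊥ᶜ ⊤ᶜ         : Concept S
  name          : ConceptName S → Concept S
  _⊔ᶜ_ _⊓_      : Concept S → Concept S → Concept S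
  _ᶜ            : Concept S → Concept S
  ∀[_]∙_ ∃[_]∙_ : RoleName S → Concept S → Concept S

-- The carrier and its predicates share the level ℓ, so that quantifying over
-- the carrier keeps the evaluation of a concept within Pred Δ ℓ.
record Model {c r : Level} (S : Signature c r) (ℓ : Level) : Set (c ⊔ r ⊔ suc ℓ) where
  field
    Δ        : Set ℓ
    nonEmpty : Δ
    concept  : ConceptName S → Pred Δ ℓ
    role     : RoleName S → Rel Δ ℓ

module _ {c r : Level} {S : Signature c r} where

  module _ {ℓ : Level} (I : Model S ℓ) where
    open Model I

    eval : Concept S → Pred Δ ℓ
    eval ⊥ᶜ          = ∅
    eval ⊤ᶜ          = U
    eval (name A)    = concept A
    eval (C ⊔ᶜ D)    = eval C ∪ eval D
    eval (C ⊓ D)     = eval C ∩ eval D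
    eval (C ᶜ)       = ∁ (eval C)
    eval (∀[ R ]∙ C) = λ x → ∀ y → role R x y → y ∈ eval C
    eval (∃[ R ]∙ C) = λ x → ∃[ y ] role R x y × y ∈ eval C

  infix 4 _⊨_⊑_
  _⊨_⊑_ : {ℓ : Level} → Model S ℓ → Concept S → Concept S → Set ℓ
  I ⊨ C ⊑ D = eval I C ⊆ eval I D

  record IsMorphism {ℓ ℓ′ : Level} (I : Model S ℓ) (I′ : Model S ℓ′)
                    (μ : Model.Δ I → Model.Δ I′) : Set (c ⊔ r ⊔ ℓ ⊔ ℓ′) where
    private
      module I  = Model I
      module I′ = Model I′
    field
      concept-⇔  : ∀ A a → (a ∈ I.concept A) ⇔ (μ a ∈ I′.concept A)
      role-forth : ∀ R a b → I.role R a b → I′.role R (μ a) (μ b)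
      role-back  : ∀ R a a′ → I′.role R (μ a) a′ →
                   ∃[ b ] I.role R a b × μ b ≡ a′

{-# OPTIONS --safe #-}
module Submission where

open import Defs
open import Data.Product using (∃-syntax; _,_)
open import Data.Product.Function.NonDependent.Propositional using (_×-⇔_)
open import Data.Sum.Function.Propositional using (_⊎-⇔_)
open import Function using (_⇔_; mk⇔; Equivalence; _∘_)
open import Level using (Level)
open import Relation.Binary.PropositionalEquality using (refl)
open import Relation.Unary using (_∈_)

open Equivalence using (to; from)

-- A morphism is a functional bisimulation, so an element and its image satisfy exactly the same
-- concepts (`eval-⇔`). An inclusion valid in `I′` therefore transfers to `I`: push `a` along `μ`,
-- apply the inclusion at `μ a`, and pull the result back.

module _ {c r ℓ ℓ′ : Level} {S : Signature c r} {I : Model S ℓ} {I′ : Model S ℓ′}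
         {μ : Model.Δ I → Model.Δ I′} (μ-morphism : IsMorphism I I′ μ) where
  open IsMorphism μ-morphism

  -- Induction on `C`. Both directions must be carried together, since complement exchanges them.
  eval-⇔ : ∀ (C : Concept S) a → (a ∈ eval I C) ⇔ (μ a ∈ eval I′ C)
  eval-⇔ ⊥ᶜ          a = mk⇔ (λ ()) (λ ())
  eval-⇔ ⊤ᶜ          a = mk⇔ _ _
  eval-⇔ (name A)    a = concept-⇔ A a
  eval-⇔ (C ⊔ᶜ D)    a = eval-⇔ C a ⊎-⇔ eval-⇔ D a
  eval-⇔ (C ⊓ D)     a = eval-⇔ C a ×-⇔ eval-⇔ D a
  eval-⇔ (C ᶜ)       a = mk⇔ (_∘ from (eval-⇔ C a)) (_∘ to (eval-⇔ C a))
  eval-⇔ (∀[ R ]∙ C) a = mk⇔ forth back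
    where
    forth : a ∈ eval I (∀[ R ]∙ C) → μ a ∈ eval I′ (∀[ R ]∙ C)
    -- A successor of `μ a` is arbitrary in `I′`; the back condition shows that it is `μ b` for a
    -- successor `b` of `a`, where the induction hypothesis applies.
    forth a∈∀ a′ Raa′ with role-back R a a′ Raa′
    ... | b , Rab , refl = to (eval-⇔ C b) (a∈∀ b Rab)

    back : μ a ∈ eval I′ (∀[ R ]∙ C) → a ∈ eval I (∀[ R ]∙ C)
    back μa∈∀ b Rab = from (eval-⇔ C b) (μa∈∀ (μ b) (role-forth R a b Rab))
  eval-⇔ (∃[ R ]∙ C) a = mk⇔ forth back
    where
    forth : a ∈ eval I (∃[ R ]∙ C) → μ a ∈ eval I′ (∃[ R ]∙ C)
    forth (b , Rab , b∈C) = μ b , role-forth R a b Rab , to (eval-⇔ C b) b∈C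

    back : μ a ∈ eval I′ (∃[ R ]∙ C) → a ∈ eval I (∃[ R ]∙ C)
    -- Dually to `∀`, the back condition now lifts the existential witness from `I′` to `I`.
    back (a′ , Raa′ , a′∈C) with role-back R a a′ Raa′
    ... | b , Rab , refl = b , Rab , from (eval-⇔ C b) a′∈C

corollary1 : ∀ {c r ℓ ℓ′ : Level} (S : Signature c r) (I : Model S ℓ) (I′ : Model S ℓ′) →
    (∃[ μ ] IsMorphism I I′ μ) →
    ∀ (C D : Concept S) → I′ ⊨ C ⊑ D → I ⊨ C ⊑ D
corollary1 S I I′ (μ , μ-morphism) C D C⊑D {a} =
  from (eval-⇔ μ-morphism D a) ∘ C⊑D ∘ to (eval-⇔ μ-morphism C a)
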